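{- Let $\mathcal{L}=\langle S, Act_\tau,\to\rangle$ be a finite-branching labelled transition system of processes. Then for every formula $\phi\in\mathrm{mayHML}$ there exists a test $t$ (a closed term of the test language) such that $\phi$ may-represents $t$; that is, for every $p\in S$, $p\ \mathbf{may\ satisfy}\ t$ if and only if $p\in[\![\phi]\!]$.
   Context: **Labelled transition systems.** An LTS over a countable set $Act$ of external actions is a triple $\langle S,Act_\tau,\to\rangle$ with $S$ a countable set of states (processes), $Act_\tau=Act\cup\{\tau\}$ where $\tau\notin Act$, and $\to\subseteq S\times Act_\tau\times S$; write $s\xrightarrow{\alpha}s'$ for $(s,\alpha,s')\in\to$, and $s\xrightarrow{\alpha}$ if such an $s'$ exists. The letter $a$ ranges over $Act$, $\alpha$ over $Act_\tau$. $\mathrm{Succ}(s)=\{s' : s\xrightarrow{\alpha}s'\text{ for some }\alpha\in Act_\tau\}$; the LTS is finite branching if $\mathrm{Succ}(s)$ is finite for all $s\in S$. Weak transitions: $\stackrel{\tau}{\Rightarrow}$ is the reflexive transitive closure of $\xrightarrow{\tau}$, and $s\stackrel{a}{\Rightarrow}s'$ means $s\stackrel{\tau}{\Rightarrow}s''\xrightarrow{a}s'''\stackrel{\tau}{\Rightarrow}s'$ for some $s'',s'''$. **The language mayHML.** It is the set of closed formulae generated by $\phi ::= \mathtt{tt}\mid\mathtt{ff}\mid X\mid\langle\alpha\rangle\phi\mid\phi_1\vee\phi_2\mid \min(X,\phi)$, where $X$ ranges over a countable set $Var$ of variables, $\alpha\in Act_\tau$, and $\min(X,\cdot)$ binds $X$.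 Given an environment $\rho:Var\to 2^S$: $[\![\mathtt{tt}]\!]\rho=S$; $[\![\mathtt{ff}]\!]\rho=\emptyset$; $[\![X]\!]\rho=\rho(X)$; $[\![\langle\alpha\rangle\phi]\!]\rho=\{s : s\stackrel{\alpha}{\Rightarrow}s'\text{ for some }s'\in[\![\phi]\!]\rho\}$; $[\![\phi_1\vee\phi_2]\!]\rho=[\![\phi_1]\!]\rho\cup[\![\phi_2]\!]\rho$; $[\![\min(X,\phi)]\!]\rho=\bigcap\{P\subseteq S : [\![\phi]\!]\rho[X\mapsto P]\subseteq P\}$. For closed $\phi$ the environment is omitted. **Tests.** Let $\omega\notin Act_\tau$. Tests are the closed terms of $t::=0\mid\alpha.t\mid\omega.0\mid X\mid t_1+t_2\mid\mu X.t$ ($\alpha\in Act_\tau$, $\mu X$ binds $X$), with transitions given by the rules: $\alpha.t\xrightarrow{\alpha}t$ for $\alpha\in Act_\tau\cup\{\omega\}$; if $t_i\xrightarrow{\alpha}t'$ for $i=1$ or $i=2$ then $t_1+t_2\xrightarrow{\alpha}t'$; $\mu X.t\xrightarrow{\tau}t\{\mu X.t/X\}$. **Testing.** For a process $p$ and test $t$, the experiment $p\,|\,t$ has only $\tau$-moves: $p|t\to p'|t$ if $p\xrightarrow{\tau}p'$; $p|t\to p|t'$ if $t\xrightarrow{\tau}t'$; $p|t\to p'|t'$ if $p\xrightarrow{a}p'$ and $t\xrightarrow{a}t'$ for some $a\in Act$. A computation of $p|t$ is a maximal (finite or infinite) path $p|t\to p_1|t_1\to\cdots$ (with $p_0=p$,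 $t_0=t$); it is successful if $t_n\xrightarrow{\omega}$ for some $n\ge0$. $p\ \mathbf{may\ satisfy}\ t$ if there exists a successful computation of $p|t$. -}

module Defs where

open import Data.Fin.Base using (Fin; zero; suc)
open import Data.List.Base using (List; []; _∷_)
open import Data.List.Membership.Propositional using (_∈_)
open import Data.List.Relation.Unary.Any using (Any)
open import Data.Nat.Base using (ℕ; zero; suc)
open import Data.Product.Base using (∃; ∃₂; _×_; _,_)
open import Data.Sum.Base using (_⊎_; inj₁; inj₂)
open import Data.Vec.Functional as Vector using (Vector)
open import Function.Bundles using (_↣_; _⇔_)
open import Level using (Lift; 0ℓ) renaming (suc to lsuc)
open import Relation.Binary.Construct.Closure.ReflexiveTransitive using (Star)
open import Relation.Binary.Core using (Rel)
open import Relation.Binary.PropositionalEquality.Core using (_≡_)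
open import Relation.Nullary.Negation.Core using (¬_)
open import Relation.Unary using (Pred; _∪_; _⊆_)
open import Relation.Unary.Polymorphic using (U; ∅)

-- Finite and empty sets count as countable.
Countable : Set → Set
Countable A = A ↣ ℕ

data Action (Act : Set) : Set where
  τ   : Action Act
  act : Act → Action Act

record LTS (Act : Set) : Set₁ where
  field
    State           : Set
    state-countable : Countable State
    _—[_]→_         : State → Action Act → State → Set

  Succ : State → Pred State 0ℓ
  Succ s s′ = ∃ λ α → s —[ α ]→ s′

  _=[_]⇒_ : State → Action Act → State → Set
  s =[ τ     ]⇒ s′ = Star (_—[ τ ]→_) s s′
  s =[ act a ]⇒ s′ = ∃₂ λ s″ s‴ → s =[ τ ]⇒ s″ × s″ —[ act a ]→ s‴ × s‴ =[ τ ]⇒ s′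

FiniteBranching : {Act : Set} → LTS Act → Set
FiniteBranching L = ∀ s → ∃ λ (xs : List State) → ∀ s′ → Succ s s′ ⇔ s′ ∈ xs
  where open LTS L

-- Formulae and tests are taken up to α-conversion: variables are de Bruijn
-- indices, n bounds the free ones, and the closed terms are those with n = 0.

data MayHML (Act : Set) (n : ℕ) : Set where
  tt ff : MayHML Act n
  var   : Fin n → MayHML Act n
  ⟨_⟩_  : Action Act → MayHML Act n → MayHML Act n
  _∨_   : MayHML Act n → MayHML Act n → MayHML Act n
  min   : MayHML Act (suc n) → MayHML Act n

module Semantics {Act : Set} (L : LTS Act) where
  open LTS L

  Env : ℕ → Set₁
  Env = Vector (Pred State 0ℓ)

  -- Subsets of the state space are predicates in Set. The intersection in the
  -- clause for min ranges over all of them, so the meaning of a formula is a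
  -- predicate in Set₁; under excluded middle this makes no difference, every
  -- proposition being equivalent to ⊤ or ⊥.
  ⟦_⟧ : ∀ {n} → MayHML Act n → Env n → Pred State (lsuc 0ℓ)
  ⟦ tt      ⟧ ρ   = U
  ⟦ ff      ⟧ ρ   = ∅
  ⟦ var X   ⟧ ρ s = Lift (lsuc 0ℓ) (ρ X s)
  ⟦ ⟨ α ⟩ φ ⟧ ρ s = ∃ λ s′ → s =[ α ]⇒ s′ × ⟦ φ ⟧ ρ s′
  ⟦ φ ∨ ψ   ⟧ ρ   = ⟦ φ ⟧ ρ ∪ ⟦ ψ ⟧ ρ
  ⟦ min φ   ⟧ ρ s = ∀ (P : Pred State 0ℓ) → ⟦ φ ⟧ (P Vector.∷ ρ) ⊆ P → P s

  ⟦_⟧₀ : MayHML Act 0 → Pred State (lsuc 0ℓ)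
  ⟦ φ ⟧₀ = ⟦ φ ⟧ Vector.[]

infixr 7 _·_
infixl 6 _+_

data Test (Act : Set) (n : ℕ) : Set where
  𝟎   : Test Act n
  _·_ : Action Act → Test Act n → Test Act n
  ω·𝟎 : Test Act n
  var : Fin n → Test Act n
  _+_ : Test Act n → Test Act n → Test Act n
  μ   : Test Act (suc n) → Test Act n

module _ {Act : Set} where

  liftRen : ∀ {m n} → (Fin m → Fin n) → Fin (suc m) → Fin (suc n)
  liftRen f zero    = zero
  liftRen f (suc X) = suc (f X)

  rename : ∀ {m n} → (Fin m → Fin n) → Test Act m → Test Act n
  rename f 𝟎       = 𝟎
  rename f (α · t) = α · rename f t
  rename f ω·𝟎     = ω·𝟎
  rename f (var X) = var (f X)
  rename f (t + u) = rename f t + rename f u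
  rename f (μ t)   = μ (rename (liftRen f) t)

  liftSub : ∀ {m n} → (Fin m → Test Act n) → Fin (suc m) → Test Act (suc n)
  liftSub σ zero    = var zero
  liftSub σ (suc X) = rename suc (σ X)

  substitute : ∀ {m n} → (Fin m → Test Act n) → Test Act m → Test Act n
  substitute σ 𝟎       = 𝟎
  substitute σ (α · t) = α · substitute σ t
  substitute σ ω·𝟎     = ω·𝟎
  substitute σ (var X) = σ X
  substitute σ (t + u) = substitute σ t + substitute σ u
  substitute σ (μ t)   = μ (substitute (liftSub σ) t)

  _[_] : ∀ {n} → Test Act (suc n) → Test Act n → Test Act n
  t [ u ] = substitute (u Vector.∷ var) t

data TestAction (Act : Set) : Set where
  ‹_› : Action Act → TestAction Act
  ω   : TestAction Act

data _—⟨_⟩→_ {Act : Set} : Test Act 0 → TestAction Act → Test Act 0 → Set where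
  prefix : ∀ {α t} → (α · t) —⟨ ‹ α › ⟩→ t
  report : ω·𝟎 —⟨ ω ⟩→ 𝟎
  sumˡ   : ∀ {t₁ t₂ t′ κ} → t₁ —⟨ κ ⟩→ t′ → (t₁ + t₂) —⟨ κ ⟩→ t′
  sumʳ   : ∀ {t₁ t₂ t′ κ} → t₂ —⟨ κ ⟩→ t′ → (t₁ + t₂) —⟨ κ ⟩→ t′
  unfold : ∀ {t} → μ t —⟨ ‹ τ › ⟩→ (t [ μ t ])

module MaximalPaths {C : Set} (_⟶_ : Rel C 0ℓ) where

  infixr 5 _∷_

  data FinitePath : C → Set where
    stop : ∀ {c} → (∀ c′ → ¬ c ⟶ c′) → FinitePath c
    _∷_  : ∀ {c c′} → c ⟶ c′ → FinitePath c′ → FinitePath c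

  states : ∀ {c} → FinitePath c → List C
  states {c} (stop _) = c ∷ []
  states {c} (_ ∷ π)  = c ∷ states π

  record InfinitePath (c : C) : Set where
    field
      state : ℕ → C
      start : state 0 ≡ c
      step  : ∀ n → state n ⟶ state (suc n)

  MaximalPath : C → Set
  MaximalPath c = FinitePath c ⊎ InfinitePath c

  Visits : ∀ {c} → Pred C 0ℓ → MaximalPath c → Set
  Visits Q (inj₁ π) = Any Q (states π)
  Visits Q (inj₂ π) = ∃ λ n → Q (InfinitePath.state π n)

module Testing {Act : Set} (L : LTS Act) where
  open LTS L

  Experiment : Set
  Experiment = State × Test Act 0

  data _⟶_ : Rel Experiment 0ℓ where
    process : ∀ {p p′ t} → p —[ τ ]→ p′ → (p , t) ⟶ (p′ , t)
    test    : ∀ {p t t′} → t —⟨ ‹ τ › ⟩→ t′ → (p , t) ⟶ (p , t′)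
    sync    : ∀ {p p′ t t′ a} → p —[ act a ]→ p′ → t —⟨ ‹ act a › ⟩→ t′ →
              (p , t) ⟶ (p′ , t′)

  open MaximalPaths _⟶_ public using (Visits) renaming (MaximalPath to Computation)

  Success : Pred Experiment 0ℓ
  Success (_ , t) = ∃ λ t′ → t —⟨ ω ⟩→ t′

  Successful : ∀ {e} → Computation e → Set
  Successful = Visits Success

  _MaySatisfy_ : State → Test Act 0 → Set
  p MaySatisfy t = ∃ λ (π : Computation (p , t)) → Successful π

module _ {Act : Set} (L : LTS Act) where
  open LTS L
  open Semantics L
  open Testing L

  MayRepresents : MayHML Act 0 → Test Act 0 → Set₁
  MayRepresents φ t = ∀ p → p MaySatisfy t ⇔ ⟦ φ ⟧₀ p

{-# OPTIONS --safe #-}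

-- A formula is translated homomorphically into a test: tt to ω·𝟎, disjunction to
-- choice, modality to prefix, least fixed point to recursion. "p may satisfy t"
-- only asks that a successful configuration be reachable from p | t, for excluded
-- middle extends every finite path to a maximal one. The set of processes that
-- may satisfy μ t is a prefixed point of the body, which gives one direction. For
-- the other, one inducts on the number of steps to success: as the unfolding of
-- μ t can be moved in front of the moves of the process, every unfolding lowers
-- this number.
module Submission where

open import Defs
open import Axiom.ExcludedMiddle using (ExcludedMiddle)
open import Data.Empty using (⊥-elim)
open import Data.Fin.Base using (Fin; zero; suc)
open import Data.List.Relation.Unary.Any using (here; there)
open import Data.Nat.Base using (ℕ; zero; suc)
open import Data.Product.Base using (Σ; ∃; _×_; _,_; proj₁; proj₂; map₂)
open import Data.Sum.Base as Sum using (_⊎_; inj₁; inj₂)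
open import Data.Vec.Functional as Vector using ()
open import Function.Base using (_∘_; id)
open import Function.Bundles using (_⇔_; mk⇔)
open import Function.Properties.Equivalence using () renaming (trans to ⇔-trans)
open import Level using (0ℓ; lift; lower)
open import Relation.Binary.Construct.Closure.ReflexiveTransitive using (ε; _◅_)
open import Relation.Binary.Core using (Rel)
open import Relation.Binary.PropositionalEquality
  using (_≡_; _≗_; refl; sym; trans; cong; cong₂; subst; module ≡-Reasoning)
open import Relation.Nullary.Decidable.Core using (yes; no)
open import Relation.Nullary.Negation.Core using (¬_)
open import Relation.Unary using (Pred)

-- Substitution in tests, and the translation of formulae

module _ {Act : Set} where

  private variable
    k m n : ℕ

  liftSub-cong : {σ σ′ : Fin m → Test Act n} → σ ≗ σ′ → liftSub σ ≗ liftSub σ′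
  liftSub-cong eq zero    = refl
  liftSub-cong eq (suc X) = cong (rename suc) (eq X)

  substitute-cong : {σ σ′ : Fin m → Test Act n} → σ ≗ σ′ → substitute σ ≗ substitute σ′
  substitute-cong eq 𝟎       = refl
  substitute-cong eq (α · t) = cong (α ·_) (substitute-cong eq t)
  substitute-cong eq ω·𝟎     = refl
  substitute-cong eq (var X) = eq X
  substitute-cong eq (t + u) = cong₂ _+_ (substitute-cong eq t) (substitute-cong eq u)
  substitute-cong eq (μ t)   = cong μ (substitute-cong (liftSub-cong eq) t)

  liftSub-var : liftSub {Act} {n} var ≗ var
  liftSub-var zero    = refl
  liftSub-var (suc X) = refl

  substitute-var : substitute {Act} {n} var ≗ id
  substitute-var 𝟎       = refl
  substitute-var (α · t) = cong (α ·_) (substitute-var t)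
  substitute-var ω·𝟎     = refl
  substitute-var (var X) = refl
  substitute-var (t + u) = cong₂ _+_ (substitute-var t) (substitute-var u)
  substitute-var (μ t)   = cong μ (trans (substitute-cong liftSub-var t) (substitute-var t))

  liftSub-liftRen : (σ : Fin n → Test Act k) (f : Fin m → Fin n) →
                    liftSub σ ∘ liftRen {Act} f ≗ liftSub (σ ∘ f)
  liftSub-liftRen σ f zero    = refl
  liftSub-liftRen σ f (suc X) = refl

  substitute-rename : (σ : Fin n → Test Act k) (f : Fin m → Fin n) →
                      substitute σ ∘ rename f ≗ substitute (σ ∘ f)
  substitute-rename σ f 𝟎       = refl
  substitute-rename σ f (α · t) = cong (α ·_) (substitute-rename σ f t)
  substitute-rename σ f ω·𝟎     = refl
  substitute-rename σ f (var X) = refl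
  substitute-rename σ f (t + u) = cong₂ _+_ (substitute-rename σ f t) (substitute-rename σ f u)
  substitute-rename σ f (μ t)   = cong μ
    (trans (substitute-rename (liftSub σ) (liftRen {Act} f) t)
           (substitute-cong (liftSub-liftRen σ f) t))

  -- Reduces the composition of two renamings to `substitute-rename`, so that `rename-rename` takes
  -- no induction under binders.
  rename≗substitute : (f : Fin m → Fin n) → rename {Act} f ≗ substitute (var ∘ f)
  rename≗substitute f t = trans (sym (substitute-var (rename f t))) (substitute-rename var f t)

  rename-rename : (g : Fin n → Fin k) (f : Fin m → Fin n) →
                  rename {Act} g ∘ rename f ≗ rename (g ∘ f)
  rename-rename g f t = begin
    rename g (rename f t)             ≡⟨ rename≗substitute g (rename f t) ⟩
    substitute (var ∘ g) (rename f t) ≡⟨ substitute-rename (var ∘ g) f t ⟩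
    substitute (var ∘ g ∘ f) t        ≡⟨ rename≗substitute (g ∘ f) t ⟨
    rename (g ∘ f) t                  ∎
    where open ≡-Reasoning

  rename-liftSub : (f : Fin n → Fin k) (σ : Fin m → Test Act n) →
                   rename (liftRen {Act} f) ∘ liftSub σ ≗ liftSub (rename f ∘ σ)
  rename-liftSub f σ zero    = refl
  rename-liftSub f σ (suc X) =
    trans (rename-rename (liftRen {Act} f) suc (σ X)) (sym (rename-rename suc f (σ X)))

  rename-substitute : (f : Fin n → Fin k) (σ : Fin m → Test Act n) →
                      rename f ∘ substitute σ ≗ substitute (rename f ∘ σ)
  rename-substitute f σ 𝟎       = refl
  rename-substitute f σ (α · t) = cong (α ·_) (rename-substitute f σ t)
  rename-substitute f σ ω·𝟎     = refl
  rename-substitute f σ (var X) = refl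
  rename-substitute f σ (t + u) = cong₂ _+_ (rename-substitute f σ t) (rename-substitute f σ u)
  rename-substitute f σ (μ t)   = cong μ
    (trans (rename-substitute (liftRen {Act} f) (liftSub σ) t)
           (substitute-cong (rename-liftSub f σ) t))

  substitute-liftSub : (σ′ : Fin n → Test Act k) (σ : Fin m → Test Act n) →
                       substitute (liftSub σ′) ∘ liftSub σ ≗ liftSub (substitute σ′ ∘ σ)
  substitute-liftSub σ′ σ zero    = refl
  substitute-liftSub σ′ σ (suc X) =
    trans (substitute-rename (liftSub σ′) suc (σ X)) (sym (rename-substitute suc σ′ (σ X)))

  substitute-substitute : (σ′ : Fin n → Test Act k) (σ : Fin m → Test Act n) →
                          substitute σ′ ∘ substitute σ ≗ substitute (substitute σ′ ∘ σ)
  substitute-substitute σ′ σ 𝟎       = refl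
  substitute-substitute σ′ σ (α · t) = cong (α ·_) (substitute-substitute σ′ σ t)
  substitute-substitute σ′ σ ω·𝟎     = refl
  substitute-substitute σ′ σ (var X) = refl
  substitute-substitute σ′ σ (t + u) =
    cong₂ _+_ (substitute-substitute σ′ σ t) (substitute-substitute σ′ σ u)
  substitute-substitute σ′ σ (μ t)   = cong μ
    (trans (substitute-substitute (liftSub σ′) (liftSub σ) t)
           (substitute-cong (substitute-liftSub σ′ σ) t))

  -- Taking `μ (substitute (liftSub σ) t)` for `u` shows that unfolding a recursive test amounts to
  -- closing its body by an extended substitution, the form to which an induction hypothesis on the
  -- body applies.
  substitute-liftSub-[] : (σ : Fin m → Test Act n) (t : Test Act (suc m)) (u : Test Act n) →
                          substitute (liftSub σ) t [ u ] ≡ substitute (u Vector.∷ σ) t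
  substitute-liftSub-[] σ t u =
    trans (substitute-substitute (u Vector.∷ var) (liftSub σ) t) (substitute-cong pointwise t)
    where
    pointwise : substitute (u Vector.∷ var) ∘ liftSub σ ≗ u Vector.∷ σ
    pointwise zero    = refl
    pointwise (suc X) =
      trans (substitute-rename (u Vector.∷ var) suc (σ X)) (substitute-var (σ X))

  toTest : MayHML Act n → Test Act n
  toTest tt        = ω·𝟎
  toTest ff        = 𝟎
  toTest (var X)   = var X
  toTest (⟨ α ⟩ φ) = α · toTest φ
  toTest (φ ∨ ψ)   = toTest φ + toTest ψ
  toTest (min φ)   = μ (toTest φ)

-- Reachability and maximal paths

module _ {C : Set} (_⟶_ : Rel C 0ℓ) where
  open MaximalPaths _⟶_

  -- The index is only an upper bound on the number of steps, as `now` is available at every index;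
  -- bounds can thus be weakened freely.
  data ReachesWithin (Q : Pred C 0ℓ) : ℕ → Pred C 0ℓ where
    now   : ∀ {n c} → Q c → ReachesWithin Q n c
    later : ∀ {n c c′} → c ⟶ c′ → ReachesWithin Q n c′ → ReachesWithin Q (suc n) c

  Reaches : Pred C 0ℓ → Pred C 0ℓ
  Reaches Q c = ∃ λ n → ReachesWithin Q n c

  module _ {Q : Pred C 0ℓ} where

    reachesWithin-suc : ∀ {n c} → ReachesWithin Q n c → ReachesWithin Q (suc n) c
    reachesWithin-suc (now q)     = now q
    reachesWithin-suc (later s r) = later s (reachesWithin-suc r)

    prepend : ∀ {c c′} → c ⟶ c′ → Reaches Q c′ → Reaches Q c
    prepend s (n , r) = suc n , later s r

    visits⇒reaches : ∀ {c} (π : MaximalPath c) → Visits Q π → Reaches Q c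
    visits⇒reaches (inj₁ π) v = finite π v
      where
      finite : ∀ {c} (π : FinitePath c) → Visits Q (inj₁ π) → Reaches Q c
      finite (stop _) (here q)  = 0 , now q
      finite (s ∷ π)  (here q)  = 0 , now q
      finite (s ∷ π)  (there v) = prepend s (finite π v)
    visits⇒reaches (inj₂ π) (n , q) = subst (Reaches Q) start (infinite n state step q)
      where
      open InfinitePath π
      -- Stated for a bare sequence, so that the induction on `n` can drop the first state.
      infinite : ∀ n (f : ℕ → C) → (∀ i → f i ⟶ f (suc i)) → Q (f n) → Reaches Q (f 0)
      infinite zero    f f-step q = 0 , now q
      infinite (suc n) f f-step q = prepend (f-step 0) (infinite n (f ∘ suc) (f-step ∘ suc) q)

    visits-start : ∀ {c} (π : MaximalPath c) → Q c → Visits Q π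
    visits-start (inj₁ (stop _)) q = here q
    visits-start (inj₁ (_ ∷ _))  q = here q
    visits-start (inj₂ π)        q = 0 , subst Q (sym (InfinitePath.start π)) q

    visits-prepend : ∀ {c c′} → c ⟶ c′ → ∃ (Visits {c′} Q) → ∃ (Visits {c} Q)
    visits-prepend         s (inj₁ π , v)       = inj₁ (s ∷ π) , there v
    visits-prepend {c = c} s (inj₂ π , (n , q)) = inj₂ path , (suc n , q)
      where
      open InfinitePath π
      path : InfinitePath c
      path = record
        { state = λ { zero → c ; (suc i) → state i }
        ; start = refl
        ; step  = λ { zero → subst (c ⟶_) (sym start) s ; (suc i) → step i }
        }

  -- If no finite maximal path starts at `c`, then some successor of `c` has none either, and
  -- iterating this choice yields an infinite path. Each state is carried along with its proof of
  -- having no finite path, and excluded middle supplies the successor itself.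
  maximalPath : ExcludedMiddle 0ℓ → ∀ c → MaximalPath c
  maximalPath em c with em {FinitePath c}
  ... | yes π = inj₁ π
  ... | no ¬π = inj₂ (record
    { state = proj₁ ∘ nth
    ; start = refl
    ; step  = λ i → proj₁ (proj₂ (extend (nth i)))
    })
    where
    Divergent : Set
    Divergent = Σ C λ c → ¬ FinitePath c

    extend : (d : Divergent) → ∃ λ c′ → proj₁ d ⟶ c′ × ¬ FinitePath c′
    extend (c , ¬π) with em {∃ λ c′ → c ⟶ c′ × ¬ FinitePath c′}
    ... | yes e = e
    -- A finite path from a successor would extend to one from `c`, so every successor would refute
    -- `¬e`. Hence `c` is stuck, and `stop` is a finite path after all.
    ... | no ¬e = ⊥-elim (¬π (stop λ c′ s → ¬e (c′ , s , λ π → ¬π (s ∷ π))))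

    nth : ℕ → Divergent
    nth zero    = c , ¬π
    nth (suc i) = map₂ proj₂ (extend (nth i))

  reaches⇒visits : ExcludedMiddle 0ℓ → ∀ {Q c} → Reaches Q c → ∃ (Visits {c} Q)
  reaches⇒visits em (_     , now q)     = maximalPath em _ , visits-start (maximalPath em _) q
  reaches⇒visits em (suc n , later s r) = visits-prepend s (reaches⇒visits em (n , r))

-- Success of tests compared with the meaning of formulae

module _ {Act : Set} (L : LTS Act) where
  open LTS L
  open Semantics L
  open Testing L

  SucceedsWithin : ℕ → State → Test Act 0 → Set
  SucceedsWithin n p t = ReachesWithin _⟶_ Success n (p , t)

  Succeeds : State → Test Act 0 → Set
  Succeeds p t = Reaches _⟶_ Success (p , t)

  succeeds-+ˡ : ∀ {n p t u} → SucceedsWithin n p t → SucceedsWithin n p (t + u)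
  succeeds-+ˡ (now (_ , w))          = now (_ , sumˡ w)
  succeeds-+ˡ (later (process s) r)  = later (process s) (succeeds-+ˡ r)
  succeeds-+ˡ (later (test s) r)     = later (test (sumˡ s)) r
  succeeds-+ˡ (later (sync s s′) r)  = later (sync s (sumˡ s′)) r

  succeeds-+ʳ : ∀ {n p t u} → SucceedsWithin n p u → SucceedsWithin n p (t + u)
  succeeds-+ʳ (now (_ , w))          = now (_ , sumʳ w)
  succeeds-+ʳ (later (process s) r)  = later (process s) (succeeds-+ʳ r)
  succeeds-+ʳ (later (test s) r)     = later (test (sumʳ s)) r
  succeeds-+ʳ (later (sync s s′) r)  = later (sync s (sumʳ s′)) r

  -- Moves of the process leave the sum intact; the first move or report of the test resolves the
  -- choice.
  succeeds-+⁻ : ∀ {n p t u} → SucceedsWithin n p (t + u) →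
                SucceedsWithin n p t ⊎ SucceedsWithin n p u
  succeeds-+⁻ (now (_ , sumˡ w))           = inj₁ (now (_ , w))
  succeeds-+⁻ (now (_ , sumʳ w))           = inj₂ (now (_ , w))
  succeeds-+⁻ (later (process s) r)        =
    Sum.map (later (process s)) (later (process s)) (succeeds-+⁻ r)
  succeeds-+⁻ (later (test (sumˡ s)) r)    = inj₁ (later (test s) r)
  succeeds-+⁻ (later (test (sumʳ s)) r)    = inj₂ (later (test s) r)
  succeeds-+⁻ (later (sync s (sumˡ s′)) r) = inj₁ (later (sync s s′) r)
  succeeds-+⁻ (later (sync s (sumʳ s′)) r) = inj₂ (later (sync s s′) r)

  succeeds-⇒τ : ∀ {p p′ t} → p =[ τ ]⇒ p′ → Succeeds p′ t → Succeeds p t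
  succeeds-⇒τ ε        r = r
  succeeds-⇒τ (s ◅ ss) r = prepend _⟶_ (process s) (succeeds-⇒τ ss r)

  succeeds-· : ∀ α {p p′ t} → p =[ α ]⇒ p′ → Succeeds p′ t → Succeeds p (α · t)
  succeeds-· τ       ss                        r =
    succeeds-⇒τ ss (prepend _⟶_ (test prefix) r)
  succeeds-· (act a) (_ , _ , ss , s , ss′) r =
    succeeds-⇒τ ss (prepend _⟶_ (sync s prefix) (succeeds-⇒τ ss′ r))

  ⇒-prepend : ∀ α {p p′ q} → p —[ τ ]→ p′ → p′ =[ α ]⇒ q → p =[ α ]⇒ q
  ⇒-prepend τ       s ss                  = s ◅ ss
  ⇒-prepend (act a) s (_ , _ , ss , rest) = _ , _ , s ◅ ss , rest

  -- The silent moves of the process before the prefix fires make up the start of the weak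
  -- transition. Those after it stay in the remaining run, so the weak transition can end with `ε`.
  -- Keeping the bound `n`, rather than lowering it, lets every constructor except `min` be treated
  -- at one fixed bound.
  succeeds-·⁻ : ∀ α {n p t} → SucceedsWithin n p (α · t) →
                ∃ λ p′ → p =[ α ]⇒ p′ × SucceedsWithin n p′ t
  succeeds-·⁻ α       (later (process s) r)     =
    map₂ (λ (ss , r) → ⇒-prepend α s ss , reachesWithin-suc _⟶_ r) (succeeds-·⁻ α r)
  succeeds-·⁻ τ       (later (test prefix) r)   = _ , ε , reachesWithin-suc _⟶_ r
  succeeds-·⁻ (act a) (later (sync s prefix) r) =
    _ , (_ , _ , ε , s , ε) , reachesWithin-suc _⟶_ r

  ¬succeeds-𝟎 : ∀ {n p} → ¬ SucceedsWithin n p 𝟎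
  ¬succeeds-𝟎 (later (process s) r) = ¬succeeds-𝟎 r

  ¬succeedsWithin0-μ : ∀ {p t} → ¬ SucceedsWithin 0 p (μ t)
  ¬succeedsWithin0-μ (now (_ , ()))

  -- The moves of the process before the unfolding do not involve the test, so they can be replayed
  -- after it; the unfolding itself is the step saved.
  succeeds-unfold : ∀ {n p t} → SucceedsWithin (suc n) p (μ t) →
                    SucceedsWithin n p (t [ μ t ])
  succeeds-unfold         (later (test unfold) r)       = r
  succeeds-unfold {suc n} (later (process s) r)         = later (process s) (succeeds-unfold r)
  -- The only step has been spent on the process, and `μ t` cannot report `ω`.
  succeeds-unfold {zero}  (later (process s) (now (_ , ())))

  -- Induction on `φ` passes through open formulae, so `σ` closes the test while `ρ` interprets the
  -- same variables; `h` ties the two together.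
  ⟦⟧⇒succeeds : ∀ {n} (φ : MayHML Act n) (ρ : Env n) (σ : Fin n → Test Act 0) →
                (∀ X {p} → ρ X p → Succeeds p (σ X)) →
                ∀ {p} → ⟦ φ ⟧ ρ p → Succeeds p (substitute σ (toTest φ))
  ⟦⟧⇒succeeds tt        ρ σ h _              = 0 , now (_ , report)
  ⟦⟧⇒succeeds ff        ρ σ h b              = ⊥-elim (lower b)
  ⟦⟧⇒succeeds (var X)   ρ σ h (lift x)       = h X x
  ⟦⟧⇒succeeds (⟨ α ⟩ φ) ρ σ h (_ , ss , x)   = succeeds-· α ss (⟦⟧⇒succeeds φ ρ σ h x)
  ⟦⟧⇒succeeds (φ ∨ ψ)   ρ σ h (inj₁ x)       = map₂ succeeds-+ˡ (⟦⟧⇒succeeds φ ρ σ h x)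
  ⟦⟧⇒succeeds (φ ∨ ψ)   ρ σ h (inj₂ x)       = map₂ succeeds-+ʳ (⟦⟧⇒succeeds ψ ρ σ h x)
  ⟦⟧⇒succeeds (min φ)   ρ σ h x              = x P prefixed
    where
    t : Test Act 0
    t = μ (substitute (liftSub σ) (toTest φ))

    -- Success is a predicate in `Set`, so it is among the sets intersected in the meaning of
    -- `min φ`.
    P : Pred State 0ℓ
    P p = Succeeds p t

    h′ : ∀ X {p} → (P Vector.∷ ρ) X p → Succeeds p ((t Vector.∷ σ) X)
    h′ zero    = id
    h′ (suc X) = h X

    prefixed : ∀ {p} → ⟦ φ ⟧ (P Vector.∷ ρ) p → P p
    prefixed {p} x = prepend _⟶_ (test unfold)
      (subst (Succeeds p) (sym (substitute-liftSub-[] σ (toTest φ) t))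
        (⟦⟧⇒succeeds φ (P Vector.∷ ρ) (t Vector.∷ σ) h′ x))

  -- The variables are controlled only for success within the same bound `k` as the conclusion. This
  -- weak demand on `h` is what the case of `min` can meet for its bound variable, by induction on
  -- `k`.
  succeeds⇒⟦⟧ : ∀ {n} (φ : MayHML Act n) (ρ : Env n) (σ : Fin n → Test Act 0) k →
                (∀ X {p} → SucceedsWithin k p (σ X) → ρ X p) →
                ∀ {p} → SucceedsWithin k p (substitute σ (toTest φ)) → ⟦ φ ⟧ ρ p
  succeeds⇒⟦⟧ tt        ρ σ k h r = _
  succeeds⇒⟦⟧ ff        ρ σ k h r = ⊥-elim (¬succeeds-𝟎 r)
  succeeds⇒⟦⟧ (var X)   ρ σ k h r = lift (h X r)
  succeeds⇒⟦⟧ (⟨ α ⟩ φ) ρ σ k h r = map₂ (map₂ (succeeds⇒⟦⟧ φ ρ σ k h)) (succeeds-·⁻ α r)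
  succeeds⇒⟦⟧ (φ ∨ ψ)   ρ σ k h r =
    Sum.map (succeeds⇒⟦⟧ φ ρ σ k h) (succeeds⇒⟦⟧ ψ ρ σ k h) (succeeds-+⁻ r)
  succeeds⇒⟦⟧ (min φ)   ρ σ k h r P prefixed = below k h r
    where
    t : Test Act 0
    t = μ (substitute (liftSub σ) (toTest φ))

    -- `h` is quantified anew because it must be restricted to the smaller bound along with `k`.
    below : ∀ k → (∀ X {p} → SucceedsWithin k p (σ X) → ρ X p) →
            ∀ {p} → SucceedsWithin k p t → P p
    below zero    h r     = ⊥-elim (¬succeedsWithin0-μ r)
    below (suc k) h {p} r = prefixed (succeeds⇒⟦⟧ φ (P Vector.∷ ρ) (t Vector.∷ σ) k h′
      (subst (SucceedsWithin k p) (substitute-liftSub-[] σ (toTest φ) t) (succeeds-unfold r)))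
      where
      h⁻ : ∀ X {p} → SucceedsWithin k p (σ X) → ρ X p
      h⁻ X = h X ∘ reachesWithin-suc _⟶_

      h′ : ∀ X {p} → SucceedsWithin k p ((t Vector.∷ σ) X) → (P Vector.∷ ρ) X p
      -- A recursive occurrence of `t` in the unfolded body has only `k` steps left instead of
      -- `suc k`.
      h′ zero    = below k h⁻
      h′ (suc X) = h⁻ X

  maySatisfy⇔succeeds : ExcludedMiddle 0ℓ → ∀ {p t} → p MaySatisfy t ⇔ Succeeds p t
  maySatisfy⇔succeeds em =
    mk⇔ (λ (π , v) → visits⇒reaches _⟶_ π v) (reaches⇒visits _⟶_ em)

  succeeds⇔⟦⟧₀ : ∀ φ {p} → Succeeds p (toTest φ) ⇔ ⟦ φ ⟧₀ p
  -- Both directions close the test by the identity substitution `var`, which `substitute-var` then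
  -- removes.
  succeeds⇔⟦⟧₀ φ {p} = subst (λ t → Succeeds p t ⇔ ⟦ φ ⟧₀ p) (substitute-var (toTest φ))
    (mk⇔ (λ (k , r) → succeeds⇒⟦⟧ φ Vector.[] var k (λ ()) r)
         (⟦⟧⇒succeeds φ Vector.[] var (λ ())))

theorem5p1 : ExcludedMiddle 0ℓ →
    (Act : Set) → Countable Act →
    (L : LTS Act) → FiniteBranching L →
    (φ : MayHML Act 0) → ∃ λ (t : Test Act 0) → MayRepresents L φ t
theorem5p1 em Act _ L _ φ =
  toTest φ , λ p → ⇔-trans (maySatisfy⇔succeeds L em) (succeeds⇔⟦⟧₀ L φ)
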